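{- There is $p=O(\log^2 n)$ such that $D^{p}(\textsc{IndSub}(P_4))=\tilde O(n)$.
   Context: $P_4$ is the path on four vertices. Insertion-only graph streaming model: the edges of an $n$-vertex undirected simple graph $G$ arrive as a stream in arbitrary order; the algorithm knows $n$, makes $p$ passes, and has bounded memory (bits). $\textsc{IndSub}(P_4)$: decide whether $G$ contains an induced subgraph isomorphic to $P_4$ (outputting its vertex set if so). $D^p(\cdot)$ is the minimum space of a deterministic $p$-pass streaming algorithm for the problem. $\tilde O$ hides polylogarithmic factors in $n$. -}

module Defs where

open import Data.Nat using (ℕ; zero; suc; _+_; _*_; _^_; _≤_)
open import Data.Nat.Logarithm using (⌊log₂_⌋)
open import Data.Fin using (Fin) renaming (_<_ to _<ᶠ_)
open import Data.Bool using (Bool)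
open import Data.Vec using (Vec; _∷_; [])
open import Data.List using (List; foldl)
open import Data.List.Membership.Propositional using (_∈_)
open import Data.List.Relation.Unary.All using (All)
open import Data.List.Relation.Unary.Unique.Propositional using (Unique)
open import Data.Maybe using (Maybe; just; nothing)
open import Data.Product using (_×_; _,_; Σ; ∃; ∃-syntax)
open import Data.Sum using (_⊎_)
open import Data.Empty using (⊥)
open import Relation.Nullary using (¬_)
open import Relation.Binary.PropositionalEquality using (_≡_; _≢_)

Edge : ℕ → Set
Edge n = Fin n × Fin n

-- An edge stream of a simple undirected graph on Fin n: every edge {u,v}
-- is written as (u , v) with u < v, and no edge occurs twice.  The graph
-- G is the one whose edge set is exactly the set of listed edges; the list
-- order is the (arbitrary) arrival order.
record EdgeStream (n : ℕ) : Set where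
  field
    edges    : List (Edge n)
    ordered  : All (λ e → Data.Product.proj₁ e <ᶠ Data.Product.proj₂ e) edges
    distinct : Unique edges
open EdgeStream public

Adj : ∀ {n} → EdgeStream n → Fin n → Fin n → Set
Adj S u v = ((u , v) ∈ edges S) ⊎ ((v , u) ∈ edges S)

InducedP4 : ∀ {n} → EdgeStream n → Fin n → Fin n → Fin n → Fin n → Set
InducedP4 S a b c d =
  (a ≢ b) × (a ≢ c) × (a ≢ d) × (b ≢ c) × (b ≢ d) × (c ≢ d) ×
  Adj S a b × Adj S b c × Adj S c d ×
  ¬ Adj S a c × ¬ Adj S b d × ¬ Adj S a d

HasInducedP4 : ∀ {n} → EdgeStream n → Set
HasInducedP4 S = ∃[ a ] ∃[ b ] ∃[ c ] ∃[ d ] InducedP4 S a b c d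

-- output: nothing = "no induced P4", just (w,x,y,z) = the vertex set {w,x,y,z}
Output : ℕ → Set
Output n = Maybe (Fin n × Fin n × Fin n × Fin n)

_∈₄_ : ∀ {n} → Fin n → Fin n × Fin n × Fin n × Fin n → Set
v ∈₄ (w , x , y , z) = (v ≡ w) ⊎ (v ≡ x) ⊎ (v ≡ y) ⊎ (v ≡ z)

Correct : ∀ {n} → EdgeStream n → Output n → Set
Correct S nothing  = ¬ HasInducedP4 S
Correct S (just o) =
  ∃[ a ] ∃[ b ] ∃[ c ] ∃[ d ]
    (a ∈₄ o) × (b ∈₄ o) × (c ∈₄ o) × (d ∈₄ o) × InducedP4 S a b c d

-- A deterministic p-pass streaming algorithm for n-vertex graphs whose
-- memory is s bits (state space Vec Bool s).  Local computation is
-- unrestricted.  In pass j (j < p) the state is updated edge by edge with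
-- 'step j'; after the last pass the output is a function of the memory.
record StreamAlg (n s p : ℕ) : Set where
  field
    init   : Vec Bool s
    step   : ℕ → Vec Bool s → Edge n → Vec Bool s
    output : Vec Bool s → Output n
open StreamAlg public

runPasses : ∀ {n s p} → StreamAlg n s p → EdgeStream n → ℕ → Vec Bool s
runPasses A S zero    = init A
runPasses A S (suc k) = foldl (step A k) (runPasses A S k) (edges S)

run : ∀ {n s p} → StreamAlg n s p → EdgeStream n → Output n
run {p = p} A S = output A (runPasses A S p)

Solves : ∀ {n s p} → StreamAlg n s p → Set
Solves {n} A = (S : EdgeStream n) → Correct S (run A S)

DSpaceAtMost : (n p s : ℕ) → Set
DSpaceAtMost n p s = Σ (StreamAlg n s p) Solves

{-# OPTIONS --safe #-}

-- There are only 2^O(n log n) cographs on n labelled vertices, since a cograph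
-- is given by a cotree with n leaves.  Hence O(n log n) fixed sets of potential
-- edges exist such that the numbers of edges of G in these sets identify G among
-- all cographs, and even among all graphs obtained from a cograph by changing
-- the neighbourhood of a single vertex; the sets are found by derandomizing the
-- choice of uniformly random sets.  One pass collects the counts, a second pass
-- checks whether the reconstructed graph is correct.
--
-- Let G_k be the graph formed by the edges of G among the first k vertices.
-- Binary search finds k such that G_k is P₄-free and G_(k+1) is not, unless
-- G itself is P₄-free.  Since G_(k+1) is a cograph up to the neighbourhood of one
-- vertex, one more pass determines it completely, and any P₄ in it is a P₄ in G.
module Submission where

open import Defs
open import Data.Nat using (ℕ; zero; suc; _+_; _*_; _^_; _≤_; _<_; s≤s; z≤n; _≟_; _<?_)
open import Data.Nat.Properties hiding (_≟_; _<?_)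
open import Data.Nat.Logarithm using (⌊log₂_⌋; ⌊log₂⌋-mono-≤; ⌊log₂[2^n]⌋≡n)
open import Data.Nat.Solver using (module +-*-Solver)
open import Data.Bool using (Bool; true; false; if_then_else_; _∧_; _∨_; not) renaming (_≟_ to _≟ᵇ_)
open import Data.Bool.Properties using (¬-not; not-involutive; ∨-comm; ∨-zeroʳ; ∧-comm; ∧-assoc; ∧-idem; ∧-zeroʳ; ∧-identityʳ; ∧-distribʳ-∨)
open import Data.Empty using (⊥; ⊥-elim)
open import Data.Fin using (Fin; zero; suc; toℕ; fromℕ<; combine; remQuot) renaming (_<_ to _<ᶠ_)
open import Data.Fin.Properties as Fin using (all?) renaming (_≟_ to _≟ᶠ_; _<?_ to _<?ᶠ_)
open import Data.List using (List; []; _∷_; _++_; length; map; filter; foldl; allFin; cartesianProduct; cartesianProductWith)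
open import Data.List.Properties using (length-++; length-map; length-tabulate; length-filter; filter-notAll; filter-some; ++-assoc; ++-identityʳ)
open import Data.List.Membership.Propositional using (_∈_; _∉_; find; lose)
open import Data.List.Membership.Propositional.Properties
  using (∈-filter⁺; ∈-filter⁻; ∈-++⁺ˡ; ∈-++⁺ʳ; ∈-++⁻; ∈-map⁺; ∈-allFin; ∈-cartesianProduct⁺; ∈-cartesianProductWith⁺)
import Data.List.Membership.DecPropositional as DecMembership
open import Data.List.Relation.Unary.All as All using ([]; _∷_)
open import Data.List.Relation.Unary.AllPairs using ([]; _∷_)
open import Data.List.Relation.Unary.Any using (here; there; any?)
open import Data.List.Relation.Unary.Unique.Propositional using (Unique)
import Data.List.Relation.Unary.Unique.Propositional.Properties as Unique
open import Data.Maybe using (just; nothing)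
open import Data.Product using (_×_; _,_; ∃-syntax; proj₁; proj₂; uncurry)
open import Data.Product.Properties using (≡-dec)
open import Data.Sum using (_⊎_; inj₁; inj₂; [_,_]′)
open import Data.Vec as Vec using (Vec; []; _∷_)
import Data.Vec.Functional as F
import Data.Vec.Properties as Vec
open import Function using (_∘_; id)
open import Relation.Binary.Definitions using (DecidableEquality)
open import Relation.Binary.PropositionalEquality
open import Relation.Nullary using (Dec; yes; no; does; ¬_; ¬?; contradiction; _×-dec_)
open import Relation.Nullary.Decidable using (dec-true; dec-false)
open import Algebra.Properties.CommutativeMonoid.Sum +-0-commutativeMonoid
  using (sum; sum-cong-≗; ∑-distrib-+; sum-replicate-zero)
open import Algebra.Properties.CommutativeSemigroup +-commutativeSemigroup
  using () renaming (interchange to +-interchange)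

-- Counting in a stream with bounded memory

⟦_⟧ : Bool → ℕ
⟦ true ⟧  = 1
⟦ false ⟧ = 0

⟦⟧-injective : ∀ {c d} → ⟦ c ⟧ ≡ ⟦ d ⟧ → c ≡ d
⟦⟧-injective {true}  {true}  _ = refl
⟦⟧-injective {false} {false} _ = refl

count : {A : Set} → (A → Bool) → List A → ℕ
count q []       = 0
count q (x ∷ xs) = ⟦ q x ⟧ + count q xs

value : ∀ {w} → Vec Bool w → ℕ
value []      = 0
value (b ∷ v) = ⟦ b ⟧ + 2 * value v

increment : ∀ {w} → Vec Bool w → Vec Bool w
increment []          = []
increment (false ∷ v) = true ∷ v
increment (true ∷ v)  = false ∷ increment v

-- A counter of all ones wraps around to zero; the bound excludes exactly this overflow.
value-increment : ∀ {w} (v : Vec Bool w) → suc (value v) < 2 ^ w →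
                  value (increment v) ≡ suc (value v)
value-increment []          (s≤s ())
value-increment (false ∷ v) _ = refl
value-increment {suc w} (true ∷ v) h =
  trans (cong (2 *_) (value-increment v
          (*-cancelˡ-< 2 _ _ (subst (_< 2 ^ suc w) (sym (*-suc 2 (value v))) h))))
        (*-suc 2 (value v))

value-zeros : ∀ w → value (Vec.replicate w false) ≡ 0
value-zeros zero    = refl
value-zeros (suc w) rewrite value-zeros w = refl

tick : ∀ {A : Set} {w} → (A → Bool) → Vec Bool w → A → Vec Bool w
tick q c x = if q x then increment c else c

value-foldl-tick : ∀ {A : Set} {w} (q : A → Bool) (c : Vec Bool w) xs →
                   value c + count q xs < 2 ^ w →
                   value (foldl (tick q) c xs) ≡ value c + count q xs
value-foldl-tick q c []       h = sym (+-identityʳ _)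
value-foldl-tick {w = w} q c (x ∷ xs) h with q x
... | false = value-foldl-tick q c xs h
... | true  = trans (value-foldl-tick q (increment c) xs (subst (λ v → v + count q xs < 2 ^ w) (sym inc) h′))
                    (trans (cong (_+ count q xs) inc) (sym (+-suc (value c) (count q xs))))
  where
  h′ : suc (value c) + count q xs < 2 ^ w
  h′ = subst (_< 2 ^ w) (+-suc (value c) (count q xs)) h
  inc : value (increment c) ≡ suc (value c)
  inc = value-increment c (≤-<-trans (m≤m+n _ _) h′)

ticks : ∀ {A : Set} {w R} → Vec (A → Bool) R → Vec (Vec Bool w) R → A → Vec (Vec Bool w) R
ticks []       []       x = []
ticks (q ∷ qs) (c ∷ cs) x = tick q c x ∷ ticks qs cs x

zeros : ∀ {w} R → Vec (Vec Bool w) R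
zeros R = Vec.replicate R (Vec.replicate _ false)

foldl-ticks-∷ : ∀ {A : Set} {w R} (q : A → Bool) (qs : Vec (A → Bool) R) (c : Vec Bool w) cs xs →
                foldl (ticks (q ∷ qs)) (c ∷ cs) xs ≡ foldl (tick q) c xs ∷ foldl (ticks qs) cs xs
foldl-ticks-∷ q qs c cs []       = refl
foldl-ticks-∷ q qs c cs (x ∷ xs) = foldl-ticks-∷ q qs (tick q c x) (ticks qs cs x) xs

counters-count : ∀ {A : Set} {w R} (qs : Vec (A → Bool) R) (xs : List A) →
                 (∀ q → count q xs < 2 ^ w) →
                 Vec.map value (foldl (ticks {w = w} qs) (zeros R) xs) ≡ Vec.map (λ q → count q xs) qs
counters-count []       xs h = foldl-[] xs
  where
  foldl-[] : ∀ xs → Vec.map value (foldl (ticks []) [] xs) ≡ []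
  foldl-[] []       = refl
  foldl-[] (x ∷ xs) = foldl-[] xs
counters-count {w = w} (q ∷ qs) xs h =
  trans (cong (Vec.map value) (foldl-ticks-∷ q qs _ _ xs))
        (cong₂ _∷_ (trans (value-foldl-tick q _ xs (subst (λ v → v + count q xs < 2 ^ w) (sym (value-zeros w)) (h q)))
                          (cong (_+ count q xs) (value-zeros w)))
                   (counters-count qs xs h))

-- Bit encodings of the memory, and adaptive programs of counting queries

record Encoding (X : Set) (s : ℕ) : Set where
  field
    encode        : X → Vec Bool s
    decode        : Vec Bool s → X
    decode-encode : ∀ x → decode (encode x) ≡ x
open Encoding

vecEncoding : ∀ {X s} → Encoding X s → ∀ k → Encoding (Vec X k) (k * s)
vecEncoding {X} {s} E = λ k → record { encode = enc k ; decode = dec k ; decode-encode = dec-enc k }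
  where
  enc : ∀ k → Vec X k → Vec Bool (k * s)
  enc zero    []       = []
  enc (suc k) (x ∷ xs) = encode E x Vec.++ enc k xs
  dec : ∀ k → Vec Bool (k * s) → Vec X k
  dec zero    _ = []
  dec (suc k) v with Vec.splitAt s v
  ... | y , z , _ = decode E y ∷ dec k z
  dec-enc : ∀ k xs → dec k (enc k xs) ≡ xs
  dec-enc zero    []       = refl
  dec-enc (suc k) (x ∷ xs) with Vec.splitAt s (encode E x Vec.++ enc k xs)
  ... | y , z , eq with Vec.++-injective (encode E x) y eq
  ... | refl , refl = cong₂ _∷_ (decode-encode E x) (dec-enc k xs)

bitsEncoding : ∀ w → Encoding (Vec Bool w) w
bitsEncoding w = record { encode = id ; decode = id ; decode-encode = λ _ → refl }

-- A decision tree whose last index is the number of passes. The `R` queries of a pass may depend on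
-- all earlier answers; the edges are seen only through counts.
data Program (n R : ℕ) : ℕ → Set where
  done : Output n → Program n R 0
  ask  : ∀ {p} → Vec (Edge n → Bool) R → (Vec ℕ R → Program n R p) → Program n R (suc p)

evaluate : ∀ {n R p} → Program n R p → List (Edge n) → Output n
evaluate (done o)  es = o
evaluate (ask q k) es = evaluate (k (Vec.map (λ r → count r es) q)) es

-- The memory keeps the counters of every pass, so that no counter is ever
-- reset and the program position is recomputed from the earlier answers.
module Compile {n R : ℕ} (w : ℕ) where

  Memory : ℕ → Set
  Memory p = Vec (Vec (Vec Bool w) R) p

  encoding : ∀ p → Encoding (Memory p) (p * (R * w))
  encoding = vecEncoding (vecEncoding (bitsEncoding w) R)

  start : ∀ p → Memory p
  start p = Vec.replicate p (zeros R)

  update : ∀ {p} → Program n R p → ℕ → Memory p → Edge n → Memory p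
  update (done _)  j       []       e = []
  update (ask q k) zero    (c ∷ cs) e = ticks q c e ∷ cs
  update (ask q k) (suc j) (c ∷ cs) e = c ∷ update (k (Vec.map value c)) j cs e

  answer : ∀ {p} → Program n R p → Memory p → Output n
  answer (done o)  []       = o
  answer (ask q k) (c ∷ cs) = answer (k (Vec.map value c)) cs

  passes : ∀ {p} → Program n R p → List (Edge n) → ℕ → Memory p
  passes P es zero    = start _
  passes P es (suc j) = foldl (update P j) (passes P es j) es

  foldl-first : ∀ {p} q (k : _ → Program n R p) c cs es →
                foldl (update (ask q k) zero) (c ∷ cs) es ≡ foldl (ticks q) c es ∷ cs
  foldl-first q k c cs []       = refl
  foldl-first q k c cs (e ∷ es) = foldl-first q k (ticks q c e) cs es

  foldl-later : ∀ {p} q (k : _ → Program n R p) j c cs es →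
                foldl (update (ask q k) (suc j)) (c ∷ cs) es ≡ c ∷ foldl (update (k (Vec.map value c)) j) cs es
  foldl-later q k j c cs []       = refl
  foldl-later q k j c cs (e ∷ es) = foldl-later q k j c (update (k (Vec.map value c)) j cs e) es

  -- The first pass fills the first row of counters and no later pass touches it. From then on the
  -- run is that of the continuation, shifted by one pass.
  passes-suc : ∀ {p} q (k : _ → Program n R p) es j →
               let c = foldl (ticks q) (zeros R) es in
               passes (ask q k) es (suc j) ≡ c ∷ passes (k (Vec.map value c)) es j
  passes-suc q k es zero    = foldl-first q k _ _ es
  passes-suc q k es (suc j) =
    trans (cong (λ m → foldl (update (ask q k) (suc j)) m es) (passes-suc q k es j))
          (foldl-later q k j _ _ es)

  answer-passes : ∀ {p} (P : Program n R p) es → (∀ q → count q es < 2 ^ w) →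
                  answer P (passes P es p) ≡ evaluate P es
  answer-passes (done o)          es h = refl
  answer-passes {suc p} (ask q k) es h =
    trans (cong (answer (ask q k)) (passes-suc q k es p))
    (trans (answer-passes (k _) es h)
           (cong (λ a → evaluate (k a) es) (counters-count q es h)))

  algorithm : ∀ {p} → Program n R p → StreamAlg n (p * (R * w)) p
  algorithm {p} P = record
    { init   = encode (encoding p) (start p)
    ; step   = λ j v e → encode (encoding p) (update P j (decode (encoding p) v) e)
    ; output = λ v → answer P (decode (encoding p) v)
    }

  module _ {p} (P : Program n R p) where

    decode-foldl : ∀ j v es → decode (encoding p) (foldl (step (algorithm P) j) v es)
                              ≡ foldl (update P j) (decode (encoding p) v) es
    decode-foldl j v []       = refl
    decode-foldl j v (e ∷ es) =
      trans (decode-foldl j _ es)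
            (cong (λ m → foldl (update P j) m es) (decode-encode (encoding p) _))

    decode-runPasses : ∀ S j → decode (encoding p) (runPasses (algorithm P) S j) ≡ passes P (edges S) j
    decode-runPasses S zero    = decode-encode (encoding p) _
    decode-runPasses S (suc j) =
      trans (decode-foldl j _ (edges S))
            (cong (λ m → foldl (update P j) m (edges S)) (decode-runPasses S j))

    run-algorithm : ∀ S → (∀ q → count q (edges S) < 2 ^ w) →
                    run (algorithm P) S ≡ evaluate P (edges S)
    run-algorithm S h = trans (cong (answer P) (decode-runPasses S p)) (answer-passes P (edges S) h)

-- Separating sets by few counts

dot : ∀ {m} → (Fin m → Bool) → (Fin m → Bool) → ℕ
dot r g = sum (λ i → ⟦ r i ∧ g i ⟧)

_≗?_ : ∀ {m} (g h : Fin m → Bool) → Dec (g ≗ h)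
g ≗? h = all? (λ i → g i ≟ᵇ h i)

total : {X : Set} → (X → ℕ) → List X → ℕ
total f []       = 0
total f (x ∷ xs) = f x + total f xs

total-mono : ∀ {X : Set} {f g : X → ℕ} → (∀ x → f x ≤ g x) → ∀ xs → total f xs ≤ total g xs
total-mono h []       = z≤n
total-mono h (x ∷ xs) = +-mono-≤ (h x) (total-mono h xs)

total-+ : ∀ {X : Set} (f g : X → ℕ) xs → total f xs + total g xs ≡ total (λ x → f x + g x) xs
total-+ f g []       = refl
total-+ f g (x ∷ xs) = trans (+-interchange (f x) _ (g x) _) (cong (f x + g x +_) (total-+ f g xs))

total-2* : ∀ {X : Set} (f : X → ℕ) xs → total (λ x → 2 * f x) xs ≡ 2 * total f xs
total-2* f []       = refl
total-2* f (x ∷ xs) = trans (cong (2 * f x +_) (total-2* f xs)) (sym (*-distribˡ-+ 2 (f x) _))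

-- Probabilities are doubled so that one half becomes an integer; a certain coincidence therefore
-- weighs 2.
tie : ∀ {P : Set} → Dec P → ℕ
tie d = if does d then 2 else 0

-- Twice the probability that a + r·g ≡ b + r·h for a uniformly random r,
-- rounded up to 1 if g and h differ.
weight : ∀ {P Q : Set} → Dec P → Dec Q → ℕ
weight d e = if does d then tie e else 1

weightOf : ∀ {m} (g h : Fin m → Bool) (a b : ℕ) → ℕ
weightOf g h a b = weight (g ≗? h) (a ≟ b)

-- The two summands correspond to leaving the first coordinate out of `r` and to putting it in. If
-- the tails differ, both are 1. If `g` and `h` agree, both choices keep the tie or both keep its
-- absence. If only the heads differ, at most one choice gives a tie, since two ties would force
-- equal heads.
weight-split : ∀ {m} (g h : Fin (suc m) → Bool) a b
               (d′ : Dec (F.tail g ≗ F.tail h)) (d : Dec (g ≗ h))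
               (e : Dec (a ≡ b)) (e′ : Dec (a + ⟦ g zero ⟧ ≡ b + ⟦ h zero ⟧)) →
               weight d′ e + weight d′ e′ ≤ 2 * weight d e
weight-split g h a b (no ¬p) (yes q) _ _ = contradiction (q ∘ suc) ¬p
weight-split g h a b (no ¬p) (no ¬q) _ _ = ≤-refl
weight-split g h a b (yes p) (yes q) (yes u) (yes v) = ≤-refl
weight-split g h a b (yes p) (yes q) (yes u) (no ¬v) = s≤s (s≤s z≤n)
weight-split g h a b (yes p) (yes q) (no ¬u) (no ¬v) = z≤n
weight-split g h a b (yes p) (yes q) (no ¬u) (yes v) =
  contradiction (+-cancelʳ-≡ ⟦ g zero ⟧ a b (trans v (cong (λ c → b + ⟦ c ⟧) (sym (q zero))))) ¬u
weight-split g h a b (yes p) (no ¬q) (yes u) (no ¬v) = ≤-refl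
weight-split g h a b (yes p) (no ¬q) (no ¬u) (yes v) = ≤-refl
weight-split g h a b (yes p) (no ¬q) (no ¬u) (no ¬v) = z≤n
weight-split g h a b (yes p) (no ¬q) (yes refl) (yes v) = contradiction g≗h ¬q
  where
  g≗h : g ≗ h
  g≗h zero    = ⟦⟧-injective (+-cancelˡ-≡ a _ _ v)
  g≗h (suc i) = p i

-- Conditional expectations: the coordinates of r are fixed one at a time,
-- never increasing the total weight.
derandomize : ∀ m {X : Set} (D : List X) (G H : X → Fin m → Bool) (A B : X → ℕ) →
              ∃[ r ] total (λ x → tie ((A x + dot r (G x)) ≟ (B x + dot r (H x)))) D
                     ≤ total (λ x → weightOf (G x) (H x) (A x) (B x)) D
derandomize zero D G H A B =
  (λ ()) , total-mono (λ x → ≤-reflexive (cong₂ (λ a b → tie (a ≟ b)) (+-identityʳ (A x)) (+-identityʳ (B x)))) D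
derandomize (suc m) D G H A B = choose (≤-total W₀ W₁)
  where
  A₁ = λ x → A x + ⟦ G x zero ⟧
  B₁ = λ x → B x + ⟦ H x zero ⟧
  W  = total (λ x → weightOf (G x) (H x) (A x) (B x)) D
  W₀ = total (λ x → weightOf (F.tail (G x)) (F.tail (H x)) (A x) (B x)) D
  W₁ = total (λ x → weightOf (F.tail (G x)) (F.tail (H x)) (A₁ x) (B₁ x)) D
  W₀+W₁≤2W : W₀ + W₁ ≤ 2 * W
  W₀+W₁≤2W = ≤-trans (≤-reflexive (total-+ _ _ D))
    (≤-trans (total-mono (λ x → weight-split (G x) (H x) (A x) (B x) (_ ≗? _) (_ ≗? _) (_ ≟ _) (_ ≟ _)) D)
             (≤-reflexive (total-2* _ D)))
  half : ∀ {u v} → u ≤ v → u + v ≤ 2 * W → u ≤ W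
  half {u} {v} u≤v h = *-cancelˡ-≤ 2 (≤-trans (+-monoʳ-≤ u (≤-trans (≤-reflexive (+-identityʳ u)) u≤v)) h)
  choose : _ → _
  choose (inj₁ W₀≤W₁) with derandomize m D (F.tail ∘ G) (F.tail ∘ H) A B
  ... | r , le = (false F.∷ r) , ≤-trans le (half W₀≤W₁ W₀+W₁≤2W)
  choose (inj₂ W₁≤W₀) with derandomize m D (F.tail ∘ G) (F.tail ∘ H) A₁ B₁
  ... | r , le = (true F.∷ r) , ≤-trans
    (total-mono (λ x → ≤-reflexive (cong₂ (λ a b → tie (a ≟ b))
      (sym (+-assoc (A x) ⟦ G x zero ⟧ _)) (sym (+-assoc (B x) ⟦ H x zero ⟧ _)))) D)
    (≤-trans le (half W₁≤W₀ (subst (_≤ 2 * W) (+-comm W₀ W₁) W₀+W₁≤2W)))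

total-tie : ∀ {X : Set} {P : X → Set} (P? : ∀ x → Dec (P x)) xs →
            total (λ x → tie (P? x)) xs ≡ 2 * length (filter P? xs)
total-tie P? []       = refl
total-tie P? (x ∷ xs) with does (P? x)
... | true  = trans (cong (2 +_) (total-tie P? xs)) (sym (*-suc 2 _))
... | false = total-tie P? xs

total-one : ∀ {X : Set} {f : X → ℕ} xs → (∀ {x} → x ∈ xs → f x ≡ 1) → total f xs ≡ length xs
total-one []       h = refl
total-one (x ∷ xs) h = cong₂ _+_ (h (here refl)) (total-one xs (h ∘ there))

dots : ∀ {m R} → Vec (Fin m → Bool) R → (Fin m → Bool) → Vec ℕ R
dots rows g = Vec.map (λ r → dot r g) rows

-- Every pair starts with weight 1, and a pair that the new row fails to separate ends with weight
-- 2. As the total does not grow, each row leaves at most half of the pairs, and after `R` rows none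
-- is left.
separate-distinct : ∀ {m} {X : Set} R (D : List X) (G H : X → Fin m → Bool) → length D < 2 ^ R →
                    (∀ {x} → x ∈ D → ¬ G x ≗ H x) →
                    ∃[ rows ] (∀ {x} → x ∈ D → dots {R = R} rows (G x) ≢ dots rows (H x))
separate-distinct zero    []      G H lt      ne = [] , λ ()
separate-distinct zero    (_ ∷ _) G H (s≤s ()) ne
separate-distinct {m} (suc R) D G H lt ne with derandomize m D G H (λ _ → 0) (λ _ → 0)
... | r , le with separate-distinct R D′ G H D′< (ne ∘ proj₁ ∘ ∈-filter⁻ bad?)
  where
  bad? = λ x → dot r (G x) ≟ dot r (H x)
  D′ = filter bad? D
  weight≡1 : ∀ {x} → x ∈ D → weightOf (G x) (H x) 0 0 ≡ 1
  weight≡1 {x} x∈D rewrite dec-false (G x ≗? H x) (ne x∈D) = refl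
  D′< : length D′ < 2 ^ R
  D′< = *-cancelˡ-< 2 _ _ (≤-<-trans
    (≤-trans (≤-reflexive (sym (total-tie bad? D))) (≤-trans le (≤-reflexive (total-one D weight≡1)))) lt)
... | rows , sep = (r ∷ rows) , λ x∈D eq →
  sep (∈-filter⁺ (λ x → dot r (G x) ≟ dot r (H x)) x∈D (proj₁ (Vec.∷-injective eq))) (proj₂ (Vec.∷-injective eq))

-- Pairs of equal sets can never be separated, so they are discarded before the halving.
separate : ∀ {m} {X : Set} R (D : List X) (G H : X → Fin m → Bool) → length D < 2 ^ R →
           ∃[ rows ] (∀ {x} → x ∈ D → dots {R = R} rows (G x) ≡ dots rows (H x) → G x ≗ H x)
separate R D G H lt
  with separate-distinct R (filter differ? D) G H
         (≤-<-trans (length-filter differ? D) lt) (proj₂ ∘ ∈-filter⁻ differ? {xs = D})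
  where
  differ? = λ x → ¬? (G x ≗? H x)
... | rows , sep = rows , conclude
  where
  conclude : ∀ {x} → x ∈ D → dots rows (G x) ≡ dots rows (H x) → G x ≗ H x
  conclude {x} x∈D eq with G x ≗? H x
  ... | yes p = p
  ... | no ¬p = contradiction eq (sep (∈-filter⁺ (λ x → ¬? (G x ≗? H x)) x∈D ¬p))

-- Cographs and cotrees

Graph : ℕ → Set
Graph n = Fin n → Fin n → Bool

Symmetric : ∀ {n} → Graph n → Set
Symmetric g = ∀ u v → g u v ≡ g v u

-- Edges and non-edges are treated as two colours, as P₄ is self-complementary.
P4Free : ∀ {n} → Bool → Graph n → Set
P4Free β g = ∀ a b c d → g a b ≡ β → g b c ≡ β → g c d ≡ β →
             g a c ≡ not β → g b d ≡ not β → g a d ≡ not β → ⊥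

-- The complement of the path a b c d is the path b d a c.
P4Free-complement : ∀ {n β} {g : Graph n} → Symmetric g → P4Free β g → P4Free (not β) g
P4Free-complement {β = β} gs free a b c d ab bc cd ac bd ad =
  free b d a c (trans bd (not-involutive β)) (trans (gs d a) (trans ad (not-involutive β)))
    (trans ac (not-involutive β)) (trans (gs b a) ab) (trans (gs d c) cd) bc

P4Free-any : ∀ {n} {g : Graph n} → Symmetric g → P4Free true g → ∀ β → P4Free β g
P4Free-any gs free true  = free
P4Free-any gs free false = P4Free-complement gs free

-- Colour `false` says that `g` is disconnected on `xs`, colour `true` that its complement is. The
-- vertices `l` and `r` witness that both sides are nonempty.
record Split {n} (g : Graph n) (xs : List (Fin n)) : Set where
  field
    side     : Fin n → Bool
    colour   : Bool
    {l r}    : Fin n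
    l∈       : l ∈ xs
    r∈       : r ∈ xs
    proper   : side l ≢ side r
    crossing : ∀ {u v} → u ∈ xs → v ∈ xs → side u ≢ side v → g u v ≡ colour

_[_↦_] : ∀ {n} → (Fin n → Bool) → Fin n → Bool → Fin n → Bool
(c [ v ↦ b ]) x = if does (x ≟ᶠ v) then b else c x

module _ {n} (c : Fin n → Bool) (v : Fin n) (b : Bool) where
  override-≡ : (c [ v ↦ b ]) v ≡ b
  override-≡ rewrite dec-true (v ≟ᶠ v) refl = refl

  override-≢ : ∀ {x} → x ≢ v → (c [ v ↦ b ]) x ≡ c x
  override-≢ {x} x≢v rewrite dec-false (x ≟ᶠ v) x≢v = refl

∈⇒≢ : ∀ {A : Set} {x v : A} {xs} → v ∉ xs → x ∈ xs → x ≢ v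
∈⇒≢ v∉ x∈ refl = v∉ x∈

module _ {n} {g : Graph n} (gs : Symmetric g) where

  isolate : ∀ {v x xs} γ → v ∉ xs → x ∈ xs → (∀ {u} → u ∈ xs → g v u ≡ γ) → Split g (v ∷ xs)
  isolate {v} {x} {xs} γ v∉ x∈ all = record
    { side = c ; colour = γ ; l∈ = here refl ; r∈ = there x∈
    ; proper = λ eq → contradiction (trans (sym (override-≡ _ v true)) (trans eq (c-false x∈))) λ ()
    ; crossing = cross }
    where
    c = (λ _ → false) [ v ↦ true ]
    c-false : ∀ {u} → u ∈ xs → c u ≡ false
    c-false u∈ = override-≢ _ v true (∈⇒≢ v∉ u∈)
    cross : ∀ {u w} → u ∈ v ∷ xs → w ∈ v ∷ xs → c u ≢ c w → g u w ≡ γ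
    cross (here refl) (here refl) ne = contradiction refl ne
    cross (here refl) (there w∈)  ne = all w∈
    cross (there u∈)  (here refl) ne = trans (gs _ _) (all u∈)
    cross (there u∈)  (there w∈)  ne = contradiction (trans (c-false u∈) (sym (c-false w∈))) ne

  -- The vertex `v` joins the side other than `σ`, so the only new crossing pairs lie between `v`
  -- and the side `σ`.
  attach : ∀ {v xs} (S : Split g xs) σ → v ∉ xs →
           (∀ {u} → u ∈ xs → Split.side S u ≡ σ → g v u ≡ Split.colour S) → Split g (v ∷ xs)
  attach {v} {xs} S σ v∉ far = record
    { side = c ; colour = colour ; l∈ = there l∈ ; r∈ = there r∈
    ; proper = λ eq → proper (trans (sym (c-old l∈)) (trans eq (c-old r∈)))
    ; crossing = cross }
    where
    open Split S
    c = side [ v ↦ not σ ]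
    c-old : ∀ {u} → u ∈ xs → c u ≡ side u
    c-old u∈ = override-≢ side v _ (∈⇒≢ v∉ u∈)
    opposite : ∀ {u} → u ∈ xs → c u ≢ c v → side u ≡ σ
    opposite {u} u∈ ne = trans (¬-not {side u} {not σ} λ eq → ne (trans (c-old u∈) (trans eq (sym (override-≡ side v _)))))
                         (not-involutive σ)
    cross : ∀ {u w} → u ∈ v ∷ xs → w ∈ v ∷ xs → c u ≢ c w → g u w ≡ colour
    cross (here refl) (here refl) ne = contradiction refl ne
    cross (here refl) (there w∈)  ne = far w∈ (opposite w∈ (ne ∘ sym))
    cross (there u∈)  (here refl) ne = trans (gs _ _) (far u∈ (opposite u∈ ne))
    cross (there u∈)  (there w∈)  ne = crossing u∈ w∈ λ eq → ne (trans (c-old u∈) (trans eq (sym (c-old w∈))))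

  -- The vertices on the side of y that are joined to v in the colour of the
  -- split form one side of the new split: if p is such a vertex, q is on the
  -- side of y but is not, and pq has the other colour, then p q v b is a P₄.
  regroup : ∀ {v xs} → (∀ β → P4Free β g) → (S : Split g xs) → v ∉ xs →
            ∀ {y b} → y ∈ xs → g v y ≡ Split.colour S → b ∈ xs → Split.side S b ≢ Split.side S y →
            g v b ≡ not (Split.colour S) →
            Split g (v ∷ xs)
  regroup {v} {xs} free S v∉ {y} {b} y∈ vy b∈ b≢y vb = record
    { side = c ; colour = colour ; l∈ = there y∈ ; r∈ = here refl
    ; proper = λ eq → contradiction (trans (sym cy) (trans eq (override-≡ c₀ v false))) λ ()
    ; crossing = cross }
    where
    open Split S
    c₀ : Fin n → Bool
    c₀ x = does (side x ≟ᵇ side y) ∧ does (g v x ≟ᵇ colour)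
    c = c₀ [ v ↦ false ]
    c-old : ∀ {u} → u ∈ xs → c u ≡ c₀ u
    c-old u∈ = override-≢ c₀ v _ (∈⇒≢ v∉ u∈)
    cy : c y ≡ true
    cy = trans (c-old y∈) (cong₂ _∧_ (dec-true (side y ≟ᵇ side y) refl) (dec-true (g v y ≟ᵇ colour) vy))
    c₀-true : ∀ {x} → c₀ x ≡ true → side x ≡ side y × g v x ≡ colour
    c₀-true {x} eq with side x ≟ᵇ side y | g v x ≟ᵇ colour
    ... | yes p | yes q = p , q
    c₀-false : ∀ {x} → c₀ x ≡ false → side x ≢ side y ⊎ (side x ≡ side y × g v x ≢ colour)
    c₀-false {x} eq with side x ≟ᵇ side y | g v x ≟ᵇ colour
    ... | yes p | no ¬q = inj₂ (p , ¬q)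
    ... | no ¬p | _     = inj₁ ¬p
    cross′ : ∀ {p q} → p ∈ v ∷ xs → q ∈ v ∷ xs → c p ≡ true → c q ≡ false → g p q ≡ colour
    cross′ (here refl) _ cp cq = contradiction (trans (sym cp) (override-≡ c₀ v false)) λ ()
    cross′ (there p∈) (here refl) cp cq = trans (gs _ _) (proj₂ (c₀-true (trans (sym (c-old p∈)) cp)))
    cross′ {p} {q} (there p∈) (there q∈) cp cq
      with c₀-true (trans (sym (c-old p∈)) cp) | c₀-false (trans (sym (c-old q∈)) cq)
    ... | py , vp | inj₁ q≢y = crossing p∈ q∈ λ eq → q≢y (trans (sym eq) py)
    ... | py , vp | inj₂ (qy , vq≢) with g p q ≟ᵇ colour
    ...   | yes pq = pq
    ...   | no ¬pq = ⊥-elim (free (not colour) p q v b (¬-not ¬pq) (trans (gs q v) (¬-not vq≢)) vb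
                       (invol (trans (gs p v) vp))
                       (invol (crossing q∈ b∈ λ eq → b≢y (trans (sym eq) qy)))
                       (invol (crossing p∈ b∈ λ eq → b≢y (trans (sym eq) py))))
      where
      invol : ∀ {x} → x ≡ colour → x ≡ not (not colour)
      invol eq = trans eq (sym (not-involutive colour))
    cross : ∀ {p q} → p ∈ v ∷ xs → q ∈ v ∷ xs → c p ≢ c q → g p q ≡ colour
    cross {p} {q} p∈ q∈ ne with c p in cp | c q in cq
    ... | true  | true  = contradiction refl ne
    ... | true  | false = cross′ p∈ q∈ cp cq
    ... | false | true  = trans (gs p q) (cross′ q∈ p∈ cq cp)
    ... | false | false = contradiction refl ne

  module _ (free : P4Free true g) where

    -- Call a vertex near if its pair with `v` does not have the colour of the split, and far
    -- otherwise. If one side has no near vertex, `v` goes to the other side. If both sides have one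
    -- and no vertex is far, `v` forms a side alone. Otherwise a far vertex `y` and a near vertex on
    -- the side opposite to `y` allow regrouping.
    extend : ∀ {v x xs} → v ∉ x ∷ xs → Split g (x ∷ xs) → Split g (v ∷ x ∷ xs)
    extend {v} {x} {xs} v∉ S with near? true | near? false
      where
      open Split S
      near? : ∀ σ → Dec _
      near? σ = any? (λ u → (side u ≟ᵇ σ) ×-dec (g v u ≟ᵇ not colour)) (x ∷ xs)
    ... | no ¬near | _ = attach S true v∉ λ {u} u∈ su →
            trans (¬-not λ eq → ¬near (lose u∈ (su , eq))) (not-involutive _)
    ... | yes _ | no ¬near = attach S false v∉ λ {u} u∈ su →
            trans (¬-not λ eq → ¬near (lose u∈ (su , eq))) (not-involutive _)
    ... | yes near₁ | yes near₀ with any? (λ u → g v u ≟ᵇ Split.colour S) (x ∷ xs)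
    ...   | no ¬far = isolate (not (Split.colour S)) v∉ (here refl) λ u∈ → ¬-not λ eq → ¬far (lose u∈ eq)
    ...   | yes far with find far | find near₁ | find near₀
    ...     | y , y∈ , vy | b₁ , b₁∈ , s₁ , vb₁ | b₀ , b₀∈ , s₀ , vb₀ with Split.side S y in sy
    ...       | true  = regroup (P4Free-any gs free) S v∉ y∈ vy b₀∈ (λ eq → contradiction (trans (sym s₀) (trans eq sy)) λ ()) vb₀
    ...       | false = regroup (P4Free-any gs free) S v∉ y∈ vy b₁∈ (λ eq → contradiction (trans (sym s₁) (trans eq sy)) λ ()) vb₁

    -- Seinsche's theorem: a P₄-free graph with at least two vertices, or its complement, is
    -- disconnected. Vertices are added one by one to an initial pair, which is split in its own
    -- colour.
    split : ∀ x y xs → Unique (x ∷ y ∷ xs) → Split g (x ∷ y ∷ xs)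
    split x y []       (x≢ ∷ _) = isolate (g x y) (λ x∈ → All.lookup x≢ x∈ refl) (here refl) λ { (here refl) → refl }
    split x y (z ∷ xs) (x≢ ∷ u) = extend (λ x∈ → All.lookup x≢ x∈ refl) (split y z xs u)

data Cotree (n : ℕ) : Set where
  leaf : Fin n → Cotree n
  node : Bool → Cotree n → Cotree n → Cotree n

leaves : ∀ {n} → Cotree n → List (Fin n)
leaves (leaf v)     = v ∷ []
leaves (node b s t) = leaves s ++ leaves t

_∈leaves_ : ∀ {n} → Fin n → Cotree n → Bool
v ∈leaves t = does (DecMembership._∈?_ _≟ᶠ_ v (leaves t))

-- When the leaves are distinct, the label of the node at which two leaves part decides their
-- adjacency; the value at a leaf serves the diagonal.
cotreeGraph : ∀ {n} → Cotree n → Graph n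
cotreeGraph (leaf _)     u v = false
cotreeGraph (node b s t) u v =
  if u ∈leaves s then (if v ∈leaves s then cotreeGraph s u v else b)
                 else (if v ∈leaves s then b else cotreeGraph t u v)

length-filter-¬ : ∀ {A : Set} {P : A → Set} (P? : ∀ x → Dec (P x)) xs →
                  length (filter P? xs) + length (filter (¬? ∘ P?) xs) ≡ length xs
length-filter-¬ P? []       = refl
length-filter-¬ P? (x ∷ xs) with P? x
... | yes _ = cong suc (length-filter-¬ P? xs)
... | no  _ = trans (+-suc _ _) (cong suc (length-filter-¬ P? xs))

record CotreeOf {n} (g : Graph n) (xs : List (Fin n)) : Set where
  field
    tree      : Cotree n
    complete  : ∀ {u} → u ∈ xs → u ∈ leaves tree
    sound     : ∀ {u} → u ∈ leaves tree → u ∈ xs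
    adjacency : ∀ {u v} → u ∈ xs → v ∈ xs → g u v ≡ cotreeGraph tree u v
    size      : length (leaves tree) ≡ length xs

  ∈leaves-true : ∀ {u} → u ∈ xs → u ∈leaves tree ≡ true
  ∈leaves-true u∈ = dec-true (DecMembership._∈?_ _≟ᶠ_ _ _) (complete u∈)

  ∈leaves-false : ∀ {u} → u ∉ xs → u ∈leaves tree ≡ false
  ∈leaves-false u∉ = dec-false (DecMembership._∈?_ _≟ᶠ_ _ _) (u∉ ∘ sound)

module _ {n} {g : Graph n} (gs : Symmetric g) (irrefl : ∀ u → g u u ≡ false) (free : P4Free true g) where

  -- The two sides become the subtrees and the colour labels the root. Soundness and completeness of
  -- the left subtree make membership among its leaves a test for the side.
  join : ∀ {xs} (S : Split g xs) →
         CotreeOf g (filter (λ x → Split.side S x ≟ᵇ Split.side S (Split.l S)) xs) →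
         CotreeOf g (filter (λ x → ¬? (Split.side S x ≟ᵇ Split.side S (Split.l S))) xs) → CotreeOf g xs
  join {xs} S L R = record
    { tree = node colour L.tree R.tree
    ; complete = complete
    ; sound = λ u∈ → [ proj₁ ∘ ∈-filter⁻ P? ∘ L.sound , proj₁ ∘ ∈-filter⁻ (¬? ∘ P?) ∘ R.sound ]′ (∈-++⁻ (leaves L.tree) u∈)
    ; adjacency = adjacency
    ; size = trans (length-++ (leaves L.tree)) (trans (cong₂ _+_ L.size R.size) (length-filter-¬ P? xs))
    }
    where
    open Split S
    module L = CotreeOf L
    module R = CotreeOf R
    P? = λ x → side x ≟ᵇ side l
    complete : ∀ {u} → u ∈ xs → u ∈ leaves L.tree ++ leaves R.tree
    complete {u} u∈ with P? u
    ... | yes p = ∈-++⁺ˡ (L.complete (∈-filter⁺ P? u∈ p))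
    ... | no ¬p = ∈-++⁺ʳ (leaves L.tree) (R.complete (∈-filter⁺ (¬? ∘ P?) u∈ ¬p))
    inL : ∀ {u} → u ∈ xs → side u ≡ side l → u ∈leaves L.tree ≡ true
    inL u∈ p = L.∈leaves-true (∈-filter⁺ P? u∈ p)
    notInL : ∀ {u} → side u ≢ side l → u ∈leaves L.tree ≡ false
    notInL ¬p = L.∈leaves-false (¬p ∘ proj₂ ∘ ∈-filter⁻ P? {xs = xs})
    adjacency : ∀ {u v} → u ∈ xs → v ∈ xs → g u v ≡ cotreeGraph (node colour L.tree R.tree) u v
    adjacency {u} {v} u∈ v∈ with P? u | P? v
    ... | yes p | yes q rewrite inL u∈ p | inL v∈ q = L.adjacency (∈-filter⁺ P? u∈ p) (∈-filter⁺ P? v∈ q)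
    ... | yes p | no ¬q rewrite inL u∈ p | notInL ¬q = crossing u∈ v∈ λ eq → ¬q (trans (sym eq) p)
    ... | no ¬p | yes q rewrite notInL ¬p | inL v∈ q = crossing u∈ v∈ λ eq → ¬p (trans eq q)
    ... | no ¬p | no ¬q rewrite notInL ¬p | notInL ¬q =
      R.adjacency (∈-filter⁺ (¬? ∘ P?) u∈ ¬p) (∈-filter⁺ (¬? ∘ P?) v∈ ¬q)

  -- The number `k` is fuel. Since `l` and `r` lie on different sides, each side is nonempty and
  -- strictly shorter than `xs`.
  cotree : ∀ k xs → length xs ≤ k → 0 < length xs → Unique xs → CotreeOf g xs
  cotree zero    xs           le lt _ = contradiction (≤-trans lt le) λ ()
  cotree (suc k) []           _  () _
  cotree (suc k) (x ∷ [])     _ _ _   = record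
    { tree = leaf x ; complete = λ u∈ → u∈ ; sound = λ u∈ → u∈
    ; adjacency = λ { (here refl) (here refl) → irrefl x } ; size = refl }
  cotree (suc k) xs@(x ∷ y ∷ zs) le _ u = join S
    (cotree k (filter P? xs) (≤-pred (≤-trans (filter-notAll P? xs (lose r∈ (proper ∘ sym))) le))
       (filter-some P? (lose l∈ refl)) (Unique.filter⁺ P? u))
    (cotree k (filter (¬? ∘ P?) xs) (≤-pred (≤-trans (filter-notAll (¬? ∘ P?) xs (lose l∈ λ ne → ne refl)) le))
       (filter-some (¬? ∘ P?) (lose r∈ (proper ∘ sym))) (Unique.filter⁺ (¬? ∘ P?) u))
    where
    S = split gs free x y zs u
    open Split S
    P? = λ x → side x ≟ᵇ side l

-- Cotrees in postfix notation.
Token : ℕ → Set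
Token n = Fin n ⊎ Bool

parse : ∀ {n} → List (Token n) → List (Cotree n) → List (Cotree n)
parse []            st           = st
parse (inj₁ v ∷ ts) st           = parse ts (leaf v ∷ st)
parse (inj₂ b ∷ ts) (t ∷ s ∷ st) = parse ts (node b s t ∷ st)
-- An operator that finds fewer than two trees is skipped, so every word parses and padding is
-- harmless.
parse (inj₂ b ∷ ts) st           = parse ts st

tokens : ∀ {n} → Cotree n → List (Token n)
tokens (leaf v)     = inj₁ v ∷ []
tokens (node b s t) = tokens s ++ tokens t ++ inj₂ b ∷ []

parse-tokens : ∀ {n} (t : Cotree n) ts st → parse (tokens t ++ ts) st ≡ parse ts (t ∷ st)
parse-tokens (leaf v)     ts st = refl
parse-tokens (node b s t) ts st = begin
  parse ((tokens s ++ tokens t ++ inj₂ b ∷ []) ++ ts) st ≡⟨ cong (λ l → parse l st) (++-assoc (tokens s) _ ts) ⟩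
  parse (tokens s ++ (tokens t ++ inj₂ b ∷ []) ++ ts) st ≡⟨ parse-tokens s _ st ⟩
  parse ((tokens t ++ inj₂ b ∷ []) ++ ts) (s ∷ st)       ≡⟨ cong (λ l → parse l (s ∷ st)) (++-assoc (tokens t) _ ts) ⟩
  parse (tokens t ++ inj₂ b ∷ ts) (s ∷ st)               ≡⟨ parse-tokens t _ (s ∷ st) ⟩
  parse ts (node b s t ∷ st)                             ∎
  where open ≡-Reasoning

-- A binary tree has one inner node fewer than leaves.
length-tokens : ∀ {n} (t : Cotree n) → suc (length (tokens t)) ≡ 2 * length (leaves t)
length-tokens (leaf v)     = refl
length-tokens (node b s t) = begin
  suc (length (tokens s ++ tokens t ++ inj₂ b ∷ []))
    ≡⟨ cong suc (trans (length-++ (tokens s)) (cong (length (tokens s) +_)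
         (trans (length-++ (tokens t)) (+-comm (length (tokens t)) 1)))) ⟩
  suc (length (tokens s)) + suc (length (tokens t)) ≡⟨ cong₂ _+_ (length-tokens s) (length-tokens t) ⟩
  2 * length (leaves s) + 2 * length (leaves t)     ≡⟨ sym (*-distribˡ-+ 2 (length (leaves s)) _) ⟩
  2 * (length (leaves s) + length (leaves t))       ≡⟨ cong (2 *_) (sym (length-++ (leaves s))) ⟩
  2 * length (leaves s ++ leaves t)                 ∎
  where open ≡-Reasoning

tokensGraph : ∀ {n} → List (Token n) → Graph n
tokensGraph ts with parse ts []
... | []    = λ _ _ → false
... | t ∷ _ = cotreeGraph t

-- The operator in front meets an empty stack and only pads the length to 2 n.
P4Free-tokens : ∀ {m} (let n = suc m) {g : Graph n} → Symmetric g → (∀ u → g u u ≡ false) → P4Free true g →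
                ∃[ ts ] length ts ≡ 2 * n × (∀ u v → g u v ≡ tokensGraph ts u v)
P4Free-tokens {m} {g} gs irrefl free = inj₂ true ∷ tokens tree , len , adj
  where
  n = suc m
  open CotreeOf (cotree gs irrefl free n (allFin n) (≤-reflexive (length-tabulate {n = n} (λ i → i))) (s≤s z≤n) (Unique.allFin⁺ n))
  len : suc (length (tokens tree)) ≡ 2 * n
  len = trans (length-tokens tree) (cong (2 *_) (trans size (length-tabulate {n = n} (λ i → i))))
  parsed : parse (inj₂ true ∷ tokens tree) [] ≡ tree ∷ []
  parsed = trans (cong (λ ts → parse ts []) (sym (++-identityʳ (tokens tree)))) (parse-tokens tree [] [])
  adj : ∀ u v → g u v ≡ tokensGraph (inj₂ true ∷ tokens tree) u v
  adj u v rewrite parsed = adjacency (∈-allFin u) (∈-allFin v)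

-- Edge sets and their truncations

⟦⟧≤1 : ∀ b → ⟦ b ⟧ ≤ 1
⟦⟧≤1 true  = ≤-refl
⟦⟧≤1 false = z≤n

true≢false : true ≢ false
true≢false ()

∧-true : ∀ {a b} → a ∧ b ≡ true → a ≡ true × b ≡ true
∧-true {true} {true} _ = refl , refl

sum-mono : ∀ {m} {s t : Fin m → ℕ} → (∀ i → s i ≤ t i) → sum s ≤ sum t
sum-mono {zero}  h = z≤n
sum-mono {suc m} h = +-mono-≤ (h zero) (sum-mono (h ∘ suc))

sum-ones : ∀ m → sum {m} (λ _ → 1) ≡ m
sum-ones zero    = refl
sum-ones (suc m) = cong suc (sum-ones m)

sum-single : ∀ {m} (t : Fin m → ℕ) i → (∀ j → j ≢ i → t j ≡ 0) → sum t ≡ t i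
sum-single {suc m} t zero    h =
  trans (cong (t zero +_) (trans (sum-cong-≗ {m} (λ j → h (suc j) λ ())) (sum-replicate-zero m))) (+-identityʳ _)
sum-single {suc m} t (suc i) h =
  cong₂ _+_ (h zero λ ()) (sum-single (t ∘ suc) i (λ j ne → h (suc j) (ne ∘ Fin.suc-injective)))

sum-tight : ∀ {m} {s t : Fin m → ℕ} → (∀ i → s i ≤ t i) → sum s ≡ sum t → s ≗ t
sum-tight {suc m} {s} {t} h eq = λ { zero → head ; (suc i) → sum-tight (h ∘ suc) tail i }
  where
  head : s zero ≡ t zero
  head = ≤-antisym (h zero) (+-cancelʳ-≤ (sum (s ∘ suc)) _ _
    (≤-trans (+-monoʳ-≤ (t zero) (sum-mono (h ∘ suc))) (≤-reflexive (sym eq))))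
  tail : sum (s ∘ suc) ≡ sum (t ∘ suc)
  tail = +-cancelˡ-≡ (s zero) _ _ (trans eq (cong (_+ sum (t ∘ suc)) (sym head)))

EdgeSet : ℕ → Set
EdgeSet n = Edge n → Bool

_≟ᵉ_ : ∀ {n} → DecidableEquality (Edge n)
_≟ᵉ_ = ≡-dec _≟ᶠ_ _≟ᶠ_

member : ∀ {n} → List (Edge n) → EdgeSet n
member es e = does (DecMembership._∈?_ _≟ᵉ_ e es)

member-true : ∀ {n} {es : List (Edge n)} {e} → e ∈ es → member es e ≡ true
member-true = dec-true (DecMembership._∈?_ _≟ᵉ_ _ _)

member-true⁻ : ∀ {n} {es : List (Edge n)} {e} → member es e ≡ true → e ∈ es
member-true⁻ {es = es} {e} eq with DecMembership._∈?_ _≟ᵉ_ e es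
... | yes p = p

flat : ∀ {n} → EdgeSet n → Fin (n * n) → Bool
flat {n} x i = x (remQuot n i)

flat-combine : ∀ {n} (x : EdgeSet n) e → flat x (uncurry combine e) ≡ x e
flat-combine x (u , v) = cong x (Fin.remQuot-combine u v)

flat-injective : ∀ {n} {x y : EdgeSet n} → flat x ≗ flat y → x ≗ y
flat-injective {x = x} {y} h e = trans (sym (flat-combine x e)) (trans (h _) (flat-combine y e))

size : ∀ {n} → EdgeSet n → ℕ
size x = sum (λ i → ⟦ flat x i ⟧)

size-cong : ∀ {n} {x y : EdgeSet n} → x ≗ y → size x ≡ size y
size-cong {n} h = sum-cong-≗ {n * n} (λ i → cong ⟦_⟧ (h _))

size≤ : ∀ {n} (x : EdgeSet n) → size x ≤ n * n
size≤ {n} x = ≤-trans (sum-mono (λ i → ⟦⟧≤1 (flat x i))) (≤-reflexive (sum-ones (n * n)))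

size-tight : ∀ {n} {x y : EdgeSet n} → (∀ e → ⟦ x e ⟧ ≤ ⟦ y e ⟧) → size x ≡ size y → x ≗ y
size-tight h eq = flat-injective (λ i → ⟦⟧-injective (sum-tight (λ i → h _) eq i))

size-single : ∀ {n} (q : EdgeSet n) e → size (λ f → does (f ≟ᵉ e) ∧ q f) ≡ ⟦ q e ⟧
size-single {n} q e =
  trans (sum-single _ (uncurry combine e) λ j j≢ → cong (λ b → ⟦ b ∧ flat q j ⟧)
          (dec-false (remQuot n j ≟ᵉ e) λ eq → j≢ (trans (sym (Fin.combine-remQuot {n} n j)) (cong (uncurry combine) eq))))
        (cong ⟦_⟧ (trans (flat-combine (λ f → does (f ≟ᵉ e) ∧ q f) e) (cong (_∧ q e) (dec-true (e ≟ᵉ e) refl))))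

-- Translates stream counters into cardinalities of edge sets; a repeated edge would be counted
-- twice, hence `Unique`.
count-member : ∀ {n} (q : EdgeSet n) {es} → Unique es → count q es ≡ size (λ e → member es e ∧ q e)
count-member {n} q {[]}     _          = sym (sum-replicate-zero (n * n))
count-member {n} q {e ∷ es} (e≢ ∷ u) = sym (begin
  size (λ f → member (e ∷ es) f ∧ q f)
    ≡⟨ sum-cong-≗ {n * n} (λ i → disjoint (remQuot n i)) ⟩
  sum (λ i → ⟦ flat (λ f → does (f ≟ᵉ e) ∧ q f) i ⟧ + ⟦ flat (λ f → member es f ∧ q f) i ⟧)
    ≡⟨ ∑-distrib-+ {n * n} _ _ ⟩
  size (λ f → does (f ≟ᵉ e) ∧ q f) + size (λ f → member es f ∧ q f)
    ≡⟨ cong₂ _+_ (size-single q e) (sym (count-member q u)) ⟩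
  ⟦ q e ⟧ + count q es ∎)
  where
  open ≡-Reasoning
  disjoint : ∀ f → ⟦ member (e ∷ es) f ∧ q f ⟧ ≡ ⟦ does (f ≟ᵉ e) ∧ q f ⟧ + ⟦ member es f ∧ q f ⟧
  disjoint f = case (f ≟ᵉ e)
    where
    or-split : ∀ b c d → (b ≡ true → c ≡ false) → ⟦ (b ∨ c) ∧ d ⟧ ≡ ⟦ b ∧ d ⟧ + ⟦ c ∧ d ⟧
    or-split true  c d h rewrite h refl = sym (+-identityʳ _)
    or-split false c d h = refl
    case : Dec (f ≡ e) → _
    case (yes refl) = or-split (does (e ≟ᵉ e)) _ _ λ _ → dec-false (DecMembership._∈?_ _≟ᵉ_ e es) λ e∈ → All.lookup e≢ e∈ refl
    case (no ne)    = or-split (does (f ≟ᵉ e)) _ _ λ eq → contradiction (trans (sym eq) (dec-false (f ≟ᵉ e) ne)) true≢false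

toGraph : ∀ {n} → EdgeSet n → Graph n
toGraph x u v = x (u , v) ∨ x (v , u)

toGraph-cong : ∀ {n} {x y : EdgeSet n} → x ≗ y → ∀ u v → toGraph x u v ≡ toGraph y u v
toGraph-cong h u v = cong₂ _∨_ (h _) (h _)

toGraph-sym : ∀ {n} (x : EdgeSet n) → Symmetric (toGraph x)
toGraph-sym x u v = ∨-comm (x (u , v)) _

Ordered : ∀ {n} → EdgeSet n → Set
Ordered x = ∀ {u v} → x (u , v) ≡ true → u <ᶠ v

toGraph-irrefl : ∀ {n} {x : EdgeSet n} → Ordered x → ∀ u → toGraph x u u ≡ false
toGraph-irrefl {x = x} ord u with x (u , u) in eq
... | false = refl
... | true  = contradiction (ord eq) (Fin.<-irrefl refl)

-- Each edge is listed only with its smaller end first, so the symmetric graph determines the edge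
-- set. Codes describe graphs, whereas sketches count edge sets.
Ordered-toGraph : ∀ {n} {x : EdgeSet n} → Ordered x → ∀ u v → x (u , v) ≡ does (u <?ᶠ v) ∧ toGraph x u v
Ordered-toGraph {x = x} ord u v with x (u , v) in eq
... | true  = sym (cong (_∧ true) (dec-true (u <?ᶠ v) (ord eq)))
... | false with x (v , u) in eq′
...   | false = sym (∧-zeroʳ _)
...   | true  = sym (cong (_∧ true) (dec-false (u <?ᶠ v) λ lt → Fin.<-asym lt (ord eq′)))

IsP4 : ∀ {n} → Graph n → Fin n → Fin n → Fin n → Fin n → Set
IsP4 g a b c d = g a b ≡ true × g b c ≡ true × g c d ≡ true × g a c ≡ false × g b d ≡ false × g a d ≡ false

IsP4-free : ∀ {n} {g : Graph n} {a b c d} → P4Free true g → ¬ IsP4 g a b c d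
IsP4-free free (ab , bc , cd , ac , bd , ad) = free _ _ _ _ ab bc cd ac bd ad

IsP4-cong : ∀ {n} {g h : Graph n} → (∀ u v → g u v ≡ h u v) → ∀ {a b c d} → IsP4 g a b c d → IsP4 h a b c d
IsP4-cong eq (ab , bc , cd , ac , bd , ad) =
  r ab , r bc , r cd , r ac , r bd , r ad
  where
  r : ∀ {u v β} → _ ≡ β → _ ≡ β
  r {u} {v} = trans (sym (eq u v))

P4Free-cong : ∀ {n} {g h : Graph n} → (∀ u v → g u v ≡ h u v) → P4Free true g → P4Free true h
P4Free-cong eq free a b c d ab bc cd ac bd ad =
  IsP4-free free (IsP4-cong (λ u v → sym (eq u v)) (ab , bc , cd , ac , bd , ad))

HasP4 : ∀ {n} → Graph n → Set
HasP4 g = ∃[ a ] ∃[ b ] ∃[ c ] ∃[ d ] IsP4 g a b c d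

abstract
  findP4 : ∀ {n} (g : Graph n) → Dec (HasP4 g)
  findP4 g = Fin.any? λ a → Fin.any? λ b → Fin.any? λ c → Fin.any? λ d →
    (g a b ≟ᵇ true) ×-dec (g b c ≟ᵇ true) ×-dec (g c d ≟ᵇ true) ×-dec
    (g a c ≟ᵇ false) ×-dec (g b d ≟ᵇ false) ×-dec (g a d ≟ᵇ false)

¬P4⇒free : ∀ {n} {g : Graph n} → ¬ HasP4 g → P4Free true g
¬P4⇒free no-P4 a b c d ab bc cd ac bd ad = no-P4 (a , b , c , d , ab , bc , cd , ac , bd , ad)

below : ∀ {n} → ℕ → Fin n → Bool
below k u = does (toℕ u <? k)

inside : ∀ {n} → ℕ → EdgeSet n
inside k (u , v) = below k u ∧ below k v

truncate : ∀ {n} → ℕ → EdgeSet n → EdgeSet n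
truncate k x e = x e ∧ inside k e

module _ {n} (x : EdgeSet n) where

  toGraph-truncate : ∀ k u v → toGraph (truncate k x) u v ≡ toGraph x u v ∧ inside k (u , v)
  toGraph-truncate k u v =
    trans (cong (λ b → x (u , v) ∧ inside k (u , v) ∨ x (v , u) ∧ b) (∧-comm (below k v) (below k u)))
          (sym (∧-distribʳ-∨ (inside k (u , v)) (x (u , v)) (x (v , u))))

  truncate-ordered : ∀ k → Ordered x → Ordered (truncate k x)
  truncate-ordered k ord eq = ord (proj₁ (∧-true eq))

  truncate-all : ∀ {k} → n ≤ k → truncate k x ≗ x
  truncate-all {k} n≤k (u , v) = trans (cong (x (u , v) ∧_) (cong₂ _∧_ (all u) (all v))) (∧-identityʳ _)
    where
    all : ∀ u → below k u ≡ true
    all u = dec-true (toℕ u <? k) (<-≤-trans (Fin.toℕ<n u) n≤k)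

  truncate-zero : P4Free true (toGraph (truncate 0 x))
  truncate-zero a b c d ab _ _ _ _ _ =
    true≢false (trans (sym ab) (trans (toGraph-truncate 0 a b) (∧-zeroʳ _)))

  -- Every vertex of the path has an incident edge that survives truncation, so all four lie below
  -- `k`. The non-edges between them are then not artefacts of truncation.
  IsP4-truncate : ∀ {k a b c d} → IsP4 (toGraph (truncate k x)) a b c d → IsP4 (toGraph x) a b c d
  IsP4-truncate {k} {a} {b} {c} {d} (ab , bc , cd , ac , bd , ad) =
    edge ab , edge bc , edge cd , non (inl ab) (inr bc) ac , non (inl bc) (inr cd) bd , non (inl ab) (inr cd) ad
    where
    parts : ∀ {u v} → toGraph (truncate k x) u v ≡ true → _
    parts {u} {v} eq = ∧-true (trans (sym (toGraph-truncate k u v)) eq)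
    edge : ∀ {u v} → toGraph (truncate k x) u v ≡ true → toGraph x u v ≡ true
    edge eq = proj₁ (parts eq)
    inl : ∀ {u v} → toGraph (truncate k x) u v ≡ true → below k u ≡ true
    inl eq = proj₁ (∧-true (proj₂ (parts eq)))
    inr : ∀ {u v} → toGraph (truncate k x) u v ≡ true → below k v ≡ true
    inr {u} eq = proj₂ (∧-true {below k u} (proj₂ (parts eq)))
    non : ∀ {u v} → below k u ≡ true → below k v ≡ true → toGraph (truncate k x) u v ≡ false → toGraph x u v ≡ false
    non {u} {v} p q eq = trans (sym (∧-identityʳ _)) (trans (cong (toGraph x u v ∧_) (sym (cong₂ _∧_ p q)))
                               (trans (sym (toGraph-truncate k u v)) eq))

-- The exception `κ` is the vertex with number `k`. Past the last vertex nothing changes and `zero`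
-- is an arbitrary choice; this case arises because the search range ends at a power of two above
-- the number of vertices.
below-suc : ∀ {m} k → ∃[ κ ] (∀ {u : Fin (suc m)} → u ≢ κ → below (suc k) u ≡ below k u)
below-suc {m} k with k <? suc m
... | yes k<n = fromℕ< k<n , λ {u} u≢ → by u (λ eq → u≢ (Fin.toℕ-injective (trans eq (sym (Fin.toℕ-fromℕ< k<n)))))
  where
  by : ∀ u → toℕ u ≢ k → below (suc k) u ≡ below k u
  by u ne with toℕ u <? k
  ... | yes lt = trans (dec-true (toℕ u <? suc k) (m<n⇒m<1+n lt)) (sym (dec-true (toℕ u <? k) lt))
  ... | no ¬lt = trans (dec-false (toℕ u <? suc k) λ { (s≤s le) → ¬lt (≤∧≢⇒< le ne) })
                       (sym (dec-false (toℕ u <? k) ¬lt))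
... | no k≮n = zero , λ {u} _ → trans (dec-true (toℕ u <? suc k) (m<n⇒m<1+n (lt u))) (sym (dec-true (toℕ u <? k) (lt u)))
  where
  lt : ∀ u → toℕ u < k
  lt u = <-≤-trans (Fin.toℕ<n u) (≮⇒≥ k≮n)

-- Enumeration of the codes for cographs with one overwritten vertex

length-cartesianProductWith : ∀ {A B C : Set} (f : A → B → C) xs ys →
                              length (cartesianProductWith f xs ys) ≡ length xs * length ys
length-cartesianProductWith f []       ys = refl
length-cartesianProductWith f (x ∷ xs) ys =
  trans (length-++ (map (f x) ys)) (cong₂ _+_ (length-map (f x) ys) (length-cartesianProductWith f xs ys))

vectors : ∀ {A : Set} k → List A → List (Vec A k)
vectors zero    as = [] ∷ []
vectors (suc k) as = cartesianProductWith _∷_ as (vectors k as)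

∈-vectors : ∀ {A : Set} {as : List A} → (∀ a → a ∈ as) → ∀ {k} (v : Vec A k) → v ∈ vectors k as
∈-vectors h []      = here refl
∈-vectors h (a ∷ v) = ∈-cartesianProductWith⁺ _∷_ (h a) (∈-vectors h v)

length-vectors : ∀ {A : Set} k (as : List A) → length (vectors k as) ≡ length as ^ k
length-vectors zero    as = refl
length-vectors (suc k) as =
  trans (length-cartesianProductWith _∷_ as (vectors k as)) (cong (length as *_) (length-vectors k as))

alphabet : ∀ n → List (Token n)
alphabet n = map inj₁ (allFin n) ++ inj₂ true ∷ inj₂ false ∷ []

∈-alphabet : ∀ {n} (t : Token n) → t ∈ alphabet n
∈-alphabet (inj₁ v)     = ∈-++⁺ˡ (∈-map⁺ inj₁ (∈-allFin v))
∈-alphabet {n} (inj₂ true)  = ∈-++⁺ʳ (map inj₁ (allFin n)) (here refl)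
∈-alphabet {n} (inj₂ false) = ∈-++⁺ʳ (map inj₁ (allFin n)) (there (here refl))

length-allFin : ∀ n → length (allFin n) ≡ n
length-allFin n = length-tabulate {n = n} (λ i → i)

length-alphabet : ∀ n → length (alphabet n) ≡ n + 2
length-alphabet n =
  trans (length-++ (map inj₁ (allFin n))) (cong (_+ 2) (trans (length-map inj₁ (allFin n)) (length-allFin n)))

bools : List Bool
bools = true ∷ false ∷ []

∈-bools : ∀ b → b ∈ bools
∈-bools true  = here refl
∈-bools false = there (here refl)

-- A cograph in which the neighbourhood of one vertex has been overwritten.
Code : ℕ → Set
Code n = Vec (Token n) (2 * n) × Fin n × Vec Bool n

codes : ∀ n → List (Code n)
codes n = cartesianProduct (vectors (2 * n) (alphabet n)) (cartesianProduct (allFin n) (vectors n bools))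

∈-codes : ∀ {n} (c : Code n) → c ∈ codes n
∈-codes (ts , κ , N) = ∈-cartesianProduct⁺ (∈-vectors ∈-alphabet ts) (∈-cartesianProduct⁺ (∈-allFin κ) (∈-vectors ∈-bools N))

length-codes : ∀ n → length (codes n) ≡ (n + 2) ^ (2 * n) * (n * 2 ^ n)
length-codes n =
  trans (length-cartesianProductWith _,_ (vectors (2 * n) (alphabet n)) _)
        (cong₂ _*_ (trans (length-vectors (2 * n) (alphabet n)) (cong (_^ (2 * n)) (length-alphabet n)))
                   (trans (length-cartesianProductWith _,_ (allFin n) _)
                          (cong₂ _*_ (length-allFin n) (length-vectors n bools))))

overwrite : ∀ {n} → Graph n → Fin n → Vec Bool n → Graph n
overwrite g κ N u v =
  if does (u ≟ᶠ κ) then Vec.lookup N v else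
  if does (v ≟ᶠ κ) then Vec.lookup N u else g u v

candidate : ∀ {n} → Code n → EdgeSet n
candidate (ts , κ , N) (u , v) = does (u <?ᶠ v) ∧ overwrite (tokensGraph (Vec.toList ts)) κ N u v

toVec : ∀ {A : Set} {k} (xs : List A) → length xs ≡ k → ∃[ v ] Vec.toList {n = k} v ≡ xs
toVec xs refl = Vec.fromList xs , Vec.toList∘fromList xs

-- The word comes from a cotree of `z` and the row of `κ` from `y`. Overwriting changes only pairs
-- that meet `κ`, so agreement on all other pairs is enough.
candidate-complete : ∀ {m} {y z : EdgeSet (suc m)} κ → Ordered y → Ordered z → P4Free true (toGraph z) →
                     (∀ {u v} → u ≢ κ → v ≢ κ → toGraph y u v ≡ toGraph z u v) →
                     ∃[ c ] candidate c ≗ y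
candidate-complete {m} {y} {z} κ oy oz free agree
  with P4Free-tokens (toGraph-sym z) (toGraph-irrefl oz) free
... | ts , len , graph with toVec ts len
... | v , refl = (v , κ , N) , λ { (u , w) → trans (cong (does (u <?ᶠ w) ∧_) (row u w)) (sym (Ordered-toGraph oy u w)) }
  where
  N = Vec.tabulate (toGraph y κ)
  row : ∀ u w → overwrite (tokensGraph (Vec.toList v)) κ N u w ≡ toGraph y u w
  row u w with u ≟ᶠ κ | w ≟ᶠ κ
  ... | yes refl | _        = Vec.lookup∘tabulate (toGraph y κ) w
  ... | no _     | yes refl = trans (Vec.lookup∘tabulate (toGraph y κ) u) (toGraph-sym y κ u)
  ... | no u≢    | no w≢    = sym (trans (agree u≢ w≢) (graph u w))

module _ {m} {x : EdgeSet (suc m)} (ord : Ordered x) (k : ℕ) (free : P4Free true (toGraph (truncate k x))) where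

  candidate-truncate : ∃[ c ] candidate c ≗ truncate k x
  -- A cograph is its own modification: the row of `zero`, an arbitrary vertex, is overwritten by
  -- itself.
  candidate-truncate = candidate-complete zero ord′ ord′ free λ _ _ → refl
    where ord′ = truncate-ordered x k ord

  -- Passing from `k` to `suc k` affects only the pairs at one vertex. Hence the next prefix still
  -- has a code, even if it contains a P₄.
  candidate-truncate-suc : ∃[ c ] candidate c ≗ truncate (suc k) x
  candidate-truncate-suc with below-suc {m} k
  ... | κ , same = candidate-complete κ (truncate-ordered x (suc k) ord) (truncate-ordered x k ord) free λ {u} {v} u≢ v≢ →
    trans (toGraph-truncate x (suc k) u v)
          (trans (cong (toGraph x u v ∧_) (cong₂ _∧_ (same u≢) (same v≢))) (sym (toGraph-truncate x k u v)))

-- Reconstruction from sketches and binary search over prefixes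

Separates : ∀ {n R} → Vec (Fin (n * n) → Bool) R → Set
Separates {n} rows = ∀ (c d : Code n) → dots rows (flat (candidate c)) ≡ dots rows (flat (candidate d)) →
                     candidate c ≗ candidate d

separating-rows : ∀ n R → length (codes n) * length (codes n) < 2 ^ R →
                  ∃[ rows ] Separates {n} {R} rows
separating-rows n R lt
  with separate R (cartesianProduct (codes n) (codes n)) (flat ∘ candidate ∘ proj₁) (flat ∘ candidate ∘ proj₂)
         (subst (_< 2 ^ R) (sym (length-cartesianProductWith _,_ (codes n) (codes n))) lt)
... | rows , sep = rows , λ c d eq → flat-injective (sep (∈-cartesianProduct⁺ (∈-codes c) (∈-codes d)) eq)

dots-cong : ∀ {m R} (rows : Vec (Fin m → Bool) R) {g h} → g ≗ h → dots rows g ≡ dots rows h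
dots-cong {m} rows eq = Vec.map-cong (λ r → sum-cong-≗ {m} (λ i → cong (λ b → ⟦ r i ∧ b ⟧) (eq i))) rows

-- A prefix k passes the test if the graph reconstructed from its sketch is P₄-free
-- and is the true one; for the latter it suffices to compare three edge counts.
module Search {m R} (rows : Vec (Fin (suc m * suc m) → Bool) (2 + R)) (sep : Separates {suc m} rows) where

  n = suc m

  sketch : ℕ → Vec (Edge n → Bool) (2 + R)
  sketch k = Vec.map (λ r e → r (uncurry combine e) ∧ inside k e) rows

  -- For a prefix without a code the result may be a wrong candidate or the empty default, so in
  -- general it has to be verified.
  reconstructIn : List (Code n) → Vec ℕ (2 + R) → EdgeSet n
  reconstructIn []       σ = λ _ → false
  reconstructIn (c ∷ cs) σ = if does (Vec.≡-dec _≟_ (dots rows (flat (candidate c))) σ) then candidate c else reconstructIn cs σ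

  reconstruct : Vec ℕ (2 + R) → EdgeSet n
  reconstruct = reconstructIn (codes n)

  -- Only two counts need the stream, as the size of `h` is known. The constant queries pad the pass
  -- to the number of counters used by a sketch.
  verify : EdgeSet n → ℕ → Vec (Edge n → Bool) (2 + R)
  verify h k = inside k ∷ (λ e → h e ∧ inside k e) ∷ Vec.replicate R (λ _ → false)

  accepted : EdgeSet n → Vec ℕ (2 + R) → Bool
  accepted h (a ∷ b ∷ _) = does (a ≟ size h) ∧ does (b ≟ size h) ∧ not (does (findP4 (toGraph h)))

  report : (g : Graph n) → Dec (HasP4 g) → Output n
  report g (yes (a , b , c , d , _)) = just (a , b , c , d)
  report g (no _)                    = nothing

  -- Each halving of the interval from `k` to `k + 2 ^ j` costs one pass for the sketch and one for
  -- the check. The final sketch is not checked: as prefix `k` is P₄-free, prefix `suc k` is sure to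
  -- have a code.
  search : ∀ j → ℕ → Program n (2 + R) (suc (j * 2))
  search zero    k = ask (sketch (suc k)) λ σ → done (report (toGraph (reconstruct σ)) (findP4 (toGraph (reconstruct σ))))
  search (suc j) k = ask (sketch (k + 2 ^ j)) λ σ → ask (verify (reconstruct σ) (k + 2 ^ j)) λ a →
                     search j (if accepted (reconstruct σ) a then k + 2 ^ j else k)

  -- The scan may stop at a code `d` other than `c`; equal sketches are all that `sep` requires to
  -- identify their graphs.
  reconstructIn-sketch : ∀ {c} cs → c ∈ cs → let σ = dots rows (flat (candidate c)) in
                    ∃[ d ] reconstructIn cs σ ≡ candidate d × dots rows (flat (candidate d)) ≡ σ
  reconstructIn-sketch {c} (d ∷ cs) c∈ with Vec.≡-dec _≟_ (dots rows (flat (candidate d))) (dots rows (flat (candidate c)))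
  reconstructIn-sketch {c} (d ∷ cs) c∈          | yes eq = d , refl , eq
  reconstructIn-sketch {c} (d ∷ cs) (here refl) | no ne  = contradiction refl ne
  reconstructIn-sketch {c} (d ∷ cs) (there c∈)  | no ne  = reconstructIn-sketch cs c∈

  reconstruct-sketch : ∀ c {y} → candidate c ≗ y → reconstruct (dots rows (flat y)) ≗ y
  reconstruct-sketch c {y} eq e with reconstructIn-sketch (codes n) (∈-codes c)
  ... | d , eq₁ , eq₂ = begin
    reconstruct (dots rows (flat y)) e             ≡⟨ cong (λ σ → reconstruct σ e) (dots-cong rows λ i → sym (eq (remQuot n i))) ⟩
    reconstruct (dots rows (flat (candidate c))) e ≡⟨ cong (λ h → h e) eq₁ ⟩
    candidate d e                             ≡⟨ sep d c eq₂ e ⟩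
    candidate c e                             ≡⟨ eq e ⟩
    y e                                       ∎
    where open ≡-Reasoning

  module _ {es : List (Edge n)} (unique : Unique es) (ord : Ordered (member es)) where

    x : EdgeSet n
    x = member es

    P4FreeTo : ℕ → Set
    P4FreeTo k = P4Free true (toGraph (truncate k x))

    sketch-count : ∀ k → Vec.map (λ q → count q es) (sketch k) ≡ dots rows (flat (truncate k x))
    sketch-count k = trans (sym (Vec.map-∘ _ _ rows)) (Vec.map-cong single rows)
      where
      swap : ∀ a b c → a ∧ (b ∧ c) ≡ b ∧ (a ∧ c)
      swap a b c = trans (sym (∧-assoc a b c)) (trans (cong (_∧ c) (∧-comm a b)) (∧-assoc b a c))
      single : ∀ r → count (λ e → r (uncurry combine e) ∧ inside k e) es ≡ dot r (flat (truncate k x))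
      single r = trans (count-member _ unique) (sum-cong-≗ {n * n} λ i → cong ⟦_⟧
        (trans (swap (flat x i) (r (uncurry combine (remQuot {n} n i))) (flat (inside k) i))
               (cong (λ j → r j ∧ flat (truncate k x) i) (Fin.combine-remQuot {n} n i))))

    accepted-count : ∀ h k → accepted h (Vec.map (λ q → count q es) (verify h k))
                     ≡ does (size (truncate k x) ≟ size h)
                       ∧ does (size (λ e → h e ∧ truncate k x e) ≟ size h) ∧ not (does (findP4 (toGraph h)))
    accepted-count h k = cong₂ (λ a b → does (a ≟ size h) ∧ does (b ≟ size h) ∧ not (does (findP4 (toGraph h))))
      (count-member (inside k) unique)
      (trans (count-member _ unique) (size-cong λ e →
        trans (sym (∧-assoc (x e) (h e) _)) (trans (cong (_∧ inside k e) (∧-comm (x e) (h e))) (∧-assoc (h e) (x e) _))))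

    does-true : ∀ {P : Set} (d : Dec P) → does d ≡ true → P
    does-true (yes p) _ = p

    -- The intersection of `h` with the prefix has the size of `h` and of the prefix, and is
    -- contained in both, so all three coincide.
    accepted-sound : ∀ h k → accepted h (Vec.map (λ q → count q es) (verify h k)) ≡ true → P4FreeTo k
    accepted-sound h k acc with ∧-true (trans (sym (accepted-count h k)) acc)
    ... | a , bc with ∧-true bc
    ... | b , c = P4Free-cong (toGraph-cong h≗) (¬P4⇒free λ p4 → true≢false (trans (sym c) (cong not (dec-true (findP4 (toGraph h)) p4))))
      where
      y = truncate k x
      sy : size y ≡ size h
      sy = does-true (size y ≟ size h) a
      sh : size (λ e → h e ∧ y e) ≡ size h
      sh = does-true (size (λ e → h e ∧ y e) ≟ size h) b
      ∧≤ˡ : ∀ b c → ⟦ b ∧ c ⟧ ≤ ⟦ b ⟧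
      ∧≤ˡ true  c = ⟦⟧≤1 c
      ∧≤ˡ false c = z≤n
      ∧≤ʳ : ∀ b c → ⟦ b ∧ c ⟧ ≤ ⟦ c ⟧
      ∧≤ʳ true  c = ≤-refl
      ∧≤ʳ false c = z≤n
      h≗ : h ≗ y
      h≗ e = trans (sym (size-tight (λ e → ∧≤ˡ (h e) (y e)) sh e)) (size-tight (λ e → ∧≤ʳ (h e) (y e)) (trans sh (sym sy)) e)

    accepted-complete : ∀ h k → h ≗ truncate k x → P4FreeTo k →
                        accepted h (Vec.map (λ q → count q es) (verify h k)) ≡ true
    accepted-complete h k h≗ free = trans (accepted-count h k)
      (cong₂ _∧_ (dec-true (size y ≟ size h) (size-cong (sym ∘ h≗)))
      (cong₂ _∧_ (dec-true (size (λ e → h e ∧ y e) ≟ size h)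
                   (size-cong λ e → trans (cong (h e ∧_) (sym (h≗ e))) (∧-idem (h e))))
                 (cong not (dec-false (findP4 (toGraph h)) λ { (_ , _ , _ , _ , p4) →
                   IsP4-free free (IsP4-cong (toGraph-cong h≗) p4) }))))
      where
      y = truncate k x

    reconstruct-sketch-count : ∀ k {c} → candidate c ≗ truncate k x →
                          reconstruct (Vec.map (λ q → count q es) (sketch k)) ≗ truncate k x
    reconstruct-sketch-count k {c} eq e = trans (cong (λ σ → reconstruct σ e) (sketch-count k)) (reconstruct-sketch c eq e)

    Valid : Output n → Set
    Valid nothing              = P4Free true (toGraph x)
    Valid (just (a , b , c , d)) = IsP4 (toGraph x) a b c d

    -- The two hypotheses are the invariant of the search. The upper end is handled by an
    -- implication, so that the case of a P₄-free input needs no separate treatment.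
    search-correct : ∀ j k → P4FreeTo k → (P4FreeTo (k + 2 ^ j) → P4Free true (toGraph x)) →
                     Valid (evaluate (search j k) es)
    search-correct zero    k free last with candidate-truncate-suc ord k free
    ... | c , eq = valid (findP4 (toGraph h))
      where
      h = reconstruct (Vec.map (λ q → count q es) (sketch (suc k)))
      h≗ : h ≗ truncate (suc k) x
      h≗ = reconstruct-sketch-count (suc k) {c} eq
      valid : (d : Dec (HasP4 (toGraph h))) → Valid (report (toGraph h) d)
      valid (yes (a , b , c , d , p4)) = IsP4-truncate x {suc k} (IsP4-cong {g = toGraph h} (toGraph-cong h≗) p4)
      -- Here the upper end is `k + 1`, so freeness of the reconstructed prefix passes to the whole
      -- graph.
      valid (no ¬p4) = last (subst P4FreeTo (+-comm 1 k) (P4Free-cong (toGraph-cong h≗) (¬P4⇒free ¬p4)))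
    search-correct (suc j) k free last =
      next (accepted h (Vec.map (λ q → count q es) (verify h (k + 2 ^ j)))) refl
      where
      h = reconstruct (Vec.map (λ q → count q es) (sketch (k + 2 ^ j)))
      next : ∀ b → accepted h (Vec.map (λ q → count q es) (verify h (k + 2 ^ j))) ≡ b →
             Valid (evaluate (search j (if b then k + 2 ^ j else k)) es)
      next true  acc = search-correct j (k + 2 ^ j) (accepted-sound h (k + 2 ^ j) acc)
        (last ∘ subst P4FreeTo (trans (+-assoc k (2 ^ j) (2 ^ j)) (cong (λ t → k + (2 ^ j + t)) (sym (+-identityʳ (2 ^ j))))))
      -- A P₄-free midpoint would have been reconstructed correctly and accepted. After a rejection
      -- the implication for the new upper end is therefore vacuous.
      next false rej = search-correct j k free λ free′ →
        let c , eq = candidate-truncate ord (k + 2 ^ j) free′ in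
        contradiction (trans (sym (accepted-complete h (k + 2 ^ j) (reconstruct-sketch-count (k + 2 ^ j) {c} eq) free′)) rej) true≢false

-- Resource bounds and the streaming model

n<2^1+log : ∀ n → n < 2 ^ suc ⌊log₂ n ⌋
n<2^1+log n = ≰⇒> λ le → <-irrefl refl
  (≤-trans (≤-reflexive (sym (⌊log₂[2^n]⌋≡n (suc ⌊log₂ n ⌋)))) (⌊log₂⌋-mono-≤ le))

module _ {n} (S : EdgeStream n) where

  private
    g : Graph n
    g = toGraph (member (edges S))

  member-ordered : Ordered (member (edges S))
  member-ordered eq = All.lookup (ordered S) (member-true⁻ eq)

  Adj⇒toGraph : ∀ {u v} → Adj S u v → g u v ≡ true
  Adj⇒toGraph {u} {v} (inj₁ uv∈) = cong (_∨ member (edges S) (v , u)) (member-true uv∈)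
  Adj⇒toGraph {u} {v} (inj₂ vu∈) = trans (cong (member (edges S) (u , v) ∨_) (member-true vu∈)) (∨-zeroʳ _)

  toGraph⇒Adj : ∀ {u v} → g u v ≡ true → Adj S u v
  toGraph⇒Adj {u} {v} eq with member (edges S) (u , v) in uv
  ... | true  = inj₁ (member-true⁻ uv)
  ... | false = inj₂ (member-true⁻ eq)

  toGraph⇒¬Adj : ∀ {u v} → g u v ≡ false → ¬ Adj S u v
  toGraph⇒¬Adj eq adj = true≢false (trans (sym (Adj⇒toGraph adj)) eq)

  -- Distinctness is automatic: identifying two of the vertices would create a loop or turn an edge
  -- into a non-edge.
  IsP4⇒InducedP4 : ∀ {a b c d} → IsP4 g a b c d → InducedP4 S a b c d
  IsP4⇒InducedP4 {a} {b} {c} {d} (ab , bc , cd , ac , bd , ad) =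
    (λ { refl → clash ab (irrefl a) }) , (λ { refl → clash cd ad }) ,
    (λ { refl → clash cd (trans (toGraph-sym (member (edges S)) c a) ac) }) , (λ { refl → clash bc (irrefl b) }) ,
    (λ { refl → clash ab ad }) , (λ { refl → clash cd (irrefl c) }) ,
    toGraph⇒Adj ab , toGraph⇒Adj bc , toGraph⇒Adj cd , toGraph⇒¬Adj ac , toGraph⇒¬Adj bd , toGraph⇒¬Adj ad
    where
    irrefl = toGraph-irrefl {x = member (edges S)} member-ordered
    clash : ∀ {b} → b ≡ true → b ≢ false
    clash refl ()

  P4Free⇒¬HasInducedP4 : P4Free true g → ¬ HasInducedP4 S
  P4Free⇒¬HasInducedP4 free (a , b , c , d , _ , _ , _ , _ , _ , _ , ab , bc , cd , ¬ac , ¬bd , ¬ad) =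
    free a b c d (Adj⇒toGraph ab) (Adj⇒toGraph bc) (Adj⇒toGraph cd) (non ¬ac) (non ¬bd) (non ¬ad)
    where
    non : ∀ {u v} → ¬ Adj S u v → g u v ≡ false
    non ¬adj = ¬-not (¬adj ∘ toGraph⇒Adj)

-- Logarithmic bounds: `2 * n` tokens and the vertex `κ` at `2 + l` bits each, plus `n` bits for its
-- row. The length is doubled because pairs of codes are to be separated.
codeLength sketchLength : ℕ → ℕ → ℕ
codeLength n l = (2 + l) * (2 * n) + ((2 + l) + n)
sketchLength n l = codeLength n l + codeLength n l

-- Passes times counters per pass times bits per counter; a count is at most the square of `n`,
-- whence `2 * suc l` bits.
memory : ℕ → ℕ → ℕ
memory n l = suc (suc l * 2) * ((2 + sketchLength n l) * (2 * suc l))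

length-codes≤ : ∀ {n l} → n < 2 ^ suc l → length (codes n) ≤ 2 ^ codeLength n l
length-codes≤ {n} {l} n< = begin
  length (codes n)                                         ≡⟨ length-codes n ⟩
  (n + 2) ^ (2 * n) * (n * 2 ^ n)                          ≤⟨ *-mono-≤ (^-monoˡ-≤ (2 * n) n+2≤) (*-monoˡ-≤ (2 ^ n) (≤-trans (m≤m+n n 2) n+2≤)) ⟩
  (2 ^ (2 + l)) ^ (2 * n) * (2 ^ (2 + l) * 2 ^ n)          ≡⟨ cong₂ _*_ (^-*-assoc 2 (2 + l) (2 * n)) (sym (^-distribˡ-+-* 2 (2 + l) n)) ⟩
  2 ^ ((2 + l) * (2 * n)) * 2 ^ ((2 + l) + n)              ≡⟨ sym (^-distribˡ-+-* 2 ((2 + l) * (2 * n)) _) ⟩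
  2 ^ codeLength n l                                       ∎
  where
  open ≤-Reasoning
  n+2≤ : n + 2 ≤ 2 ^ (2 + l)
  n+2≤ = begin
    n + 2                       ≡⟨ +-suc n 1 ⟩
    suc n + 1                   ≤⟨ +-mono-≤ n< (m^n>0 2 (suc l)) ⟩
    2 ^ suc l + 2 ^ suc l       ≡⟨ cong (2 ^ suc l +_) (sym (+-identityʳ _)) ⟩
    2 ^ (2 + l)                 ∎

codes²< : ∀ {n l} → n < 2 ^ suc l → length (codes n) * length (codes n) < 2 ^ (2 + sketchLength n l)
codes²< {n} {l} n< = ≤-<-trans
  (≤-trans (*-mono-≤ (length-codes≤ n<) (length-codes≤ n<)) (≤-reflexive (sym (^-distribˡ-+-* 2 (codeLength n l) _))))
  -- The two extra rows that make room for `verify` also make the inequality strict.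
  (^-monoʳ-< 2 (s≤s (s≤s z≤n)) (m<n+m (sketchLength n l) {2} (s≤s z≤n)))

n²< : ∀ {n l} → n < 2 ^ suc l → n * n < 2 ^ (2 * suc l)
n²< {n} {l} n< = <-≤-trans (*-mono-< n< n<)
  (≤-reflexive (trans (sym (^-distribˡ-+-* 2 (suc l) (suc l))) (cong (λ t → 2 ^ (suc l + t)) (sym (+-identityʳ (suc l))))))

-- The constant 440 is 5 · 22 · 4, from the bounds on passes, counters and bits for positive `l`.
-- The additive 440 covers `l` zero, where `n` is 1 and the memory has 96 bits.
memory≤ : ∀ {n} l → 0 < n → n < 2 ^ suc l → memory n l ≤ 440 * n * l ^ 3 + 440
memory≤ {n} zero 0<n n<2 with ≤-antisym (≤-pred n<2) 0<n
... | refl = m≤m+n 96 344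
memory≤ {n} l@(suc _) 0<n _ = begin
  suc (suc l * 2) * ((2 + sketchLength n l) * (2 * suc l)) ≤⟨ *-mono-≤ p≤ (*-mono-≤ R≤ w≤) ⟩
  5 * l * (22 * (l * n) * (4 * l))                         ≡⟨ solve 2 (λ l n → con 5 :* l :* (con 22 :* (l :* n) :* (con 4 :* l)) := con 440 :* n :* (l :* (l :* (l :* con 1)))) refl l n ⟩
  440 * n * l ^ 3                                          ≤⟨ m≤m+n _ 440 ⟩
  440 * n * l ^ 3 + 440                                    ∎
  where
  open ≤-Reasoning
  open +-*-Solver
  1≤l : 1 ≤ l
  1≤l = s≤s z≤n
  const≤ : ∀ c → c ≤ c * l
  const≤ c = m≤m*n c l
  l≤ln : l ≤ l * n
  l≤ln = ≤-trans (≤-reflexive (sym (*-identityʳ l))) (*-monoʳ-≤ l 0<n)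
  n≤ln : n ≤ l * n
  n≤ln = m≤n*m n l
  a≤ : 2 + l ≤ 3 * l
  a≤ = ≤-trans (+-monoˡ-≤ l (const≤ 2)) (≤-reflexive (solve 1 (λ l → con 2 :* l :+ l := con 3 :* l) refl l))
  p≤ : suc (suc l * 2) ≤ 5 * l
  p≤ = ≤-trans (+-monoˡ-≤ (l * 2) (const≤ 3)) (≤-reflexive (solve 1 (λ l → con 3 :* l :+ l :* con 2 := con 5 :* l) refl l))
  w≤ : 2 * suc l ≤ 4 * l
  w≤ = ≤-trans (≤-reflexive (*-suc 2 l)) (≤-trans (+-monoˡ-≤ (2 * l) (const≤ 2)) (≤-reflexive (sym (*-distribʳ-+ l 2 2))))
  E≤ : codeLength n l ≤ 10 * (l * n)
  E≤ = begin
    (2 + l) * (2 * n) + ((2 + l) + n)      ≤⟨ +-mono-≤ (*-monoˡ-≤ (2 * n) a≤) (+-mono-≤ (≤-trans a≤ (*-monoʳ-≤ 3 l≤ln)) n≤ln) ⟩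
    3 * l * (2 * n) + (3 * (l * n) + l * n) ≡⟨ solve 2 (λ l n → con 3 :* l :* (con 2 :* n) :+ (con 3 :* (l :* n) :+ l :* n) := con 10 :* (l :* n)) refl l n ⟩
    10 * (l * n)                            ∎
  R≤ : 2 + sketchLength n l ≤ 22 * (l * n)
  R≤ = begin
    2 + sketchLength n l                       ≤⟨ +-mono-≤ (*-monoʳ-≤ 2 (≤-trans 1≤l l≤ln)) (+-mono-≤ E≤ E≤) ⟩
    2 * (l * n) + (10 * (l * n) + 10 * (l * n)) ≡⟨ solve 1 (λ x → con 2 :* x :+ (con 10 :* x :+ con 10 :* x) := con 22 :* x) refl (l * n) ⟩
    22 * (l * n)                               ∎

-- The number of passes is in fact linear in `l`; the constant is the one required for the memory.
passes≤ : ∀ l → suc (suc l * 2) ≤ 440 * l ^ 2 + 440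
passes≤ zero      = m≤m+n 3 437
passes≤ l@(suc _) = begin
  3 + l * 2         ≡⟨ +-comm 3 (l * 2) ⟩
  l * 2 + 3         ≤⟨ +-mono-≤ l2≤ (m≤m+n 3 437) ⟩
  440 * l ^ 2 + 440 ∎
  where
  open ≤-Reasoning
  l2≤ : l * 2 ≤ 440 * l ^ 2
  l2≤ = begin
    l * 2       ≡⟨ *-comm l 2 ⟩
    2 * l       ≤⟨ *-mono-≤ (m≤m+n 2 438) (m≤m*n l (l * 1) {{m*n≢0 l 1}}) ⟩
    440 * l ^ 2 ∎

-- The rows depend only on the parameters and not on the stream. They belong to the algorithm and
-- occupy no memory.
cograph-algorithm : ∀ m l → suc m < 2 ^ suc l → DSpaceAtMost (suc m) (suc (suc l * 2)) (memory (suc m) l)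
cograph-algorithm m l n< = solution (separating-rows n (2 + sketchLength n l) (codes²< {n} {l} n<))
  where
  n = suc m
  solution : ∃[ rows ] Separates {n} {2 + sketchLength n l} rows → DSpaceAtMost n (suc (suc l * 2)) (memory n l)
  solution (rows , sep) = algorithm (search (suc l) 0) , solves
    where
    open Search {m} {sketchLength n l} rows sep using (search; search-correct; Valid)
    open Compile {n} {2 + sketchLength n l} (2 * suc l)
    correct : ∀ S o → Valid (distinct S) (member-ordered S) o → Correct S o
    correct S nothing              free = P4Free⇒¬HasInducedP4 S free
    correct S (just (a , b , c , d)) p4 = a , b , c , d , inj₁ refl , inj₂ (inj₁ refl) , inj₂ (inj₂ (inj₁ refl)) ,
      inj₂ (inj₂ (inj₂ refl)) , IsP4⇒InducedP4 S p4
    solves : Solves (algorithm (search (suc l) 0))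
    solves S = subst (Correct S) (sym (run-algorithm (search (suc l) 0) S counts<)) (correct S _
      -- The search starts with the empty prefix and ends at `2 ^ suc l`, beyond the last vertex,
      -- where the truncation is the whole graph.
      (search-correct (distinct S) (member-ordered S) (suc l) 0 (truncate-zero x)
        (P4Free-cong (toGraph-cong (truncate-all x (<⇒≤ n<))))))
      where
      x = member (edges S)
      counts< : ∀ q → count q (edges S) < 2 ^ (2 * suc l)
      counts< q = ≤-<-trans (≤-trans (≤-reflexive (count-member q (distinct S))) (size≤ (λ e → x e ∧ q e))) (n²< {n} {l} n<)

theorem27 : ∃[ c ] ∃[ k ] ((n : ℕ) → ∃[ p ] ∃[ s ]
    (p ≤ c * ⌊log₂ n ⌋ ^ 2 + c) × (s ≤ c * n * ⌊log₂ n ⌋ ^ k + c) ×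
    DSpaceAtMost n p s)
theorem27 = 440 , 3 , λ
  -- Without vertices there is no P₄, and neither passes nor memory are used.
  { zero    → 0 , 0 , z≤n , z≤n , record { init = [] ; step = λ _ v _ → v ; output = λ _ → nothing } , λ _ → λ ()
  ; (suc m) → let l = ⌊log₂ suc m ⌋ in
      suc (suc l * 2) , memory (suc m) l , passes≤ l , memory≤ l (s≤s z≤n) (n<2^1+log (suc m)) , cograph-algorithm m l (n<2^1+log (suc m))
  }
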